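{- Let $M$ be a hypergraph model and let $E$ be a hyperedge in $M$. (1) If $M\in\mathcal{H}_n^{su}$ (i.e. $M$ is simple and $n$-uniform), then for all $\varphi\in\mathcal{L}_B$: $M,E\models_{H}\varphi$ if and only if $\mathfrak{K}(M),E\models_{K}\varphi$. (2) If $M\in\mathcal{H}_n^{sut}$ (i.e. $M$ is simple, $n$-uniform and tail-complete), then for all $\varphi\in\mathcal{L}_B^K$: $M,E\models_{H}\varphi$ if and only if $\mathfrak{K}(M),E\models_{K}\varphi$. Here $\mathfrak{K}(M)$ is the Kripke model associated with $M$.
   Context: Fix a set $\mathcal{A}$ of $n\geq 1$ agents (finite, $|\mathcal{A}|=n$). Each $a\in\mathcal{A}$ has a countable set $\mathsf{Var}_a$ of propositional letters; these sets are pairwise disjoint, and $\mathsf{Var}:=\bigcup_{a\in\mathcal{A}}\mathsf{Var}_a$. The language $\mathcal{L}_B^K$ is generated by $\varphi::=p\mid\neg\varphi\mid\varphi\wedge\varphi\mid B_a\varphi\mid K_a\varphi$ ($p\in\mathsf{Var}$, $a\in\mathcal{A}$); $\mathcal{L}_B$ is its fragment without the operators $K_a$. Kripke models. A doxastic Kripke model is a triple $N=(W,R,V)$ with $W\neq\emptyset$ a set, $R$ assigning to each $a\in\mathcal{A}$ a relation $R_a\subseteq W\times W$, and $V:W\to\mathcal{P}(\mathsf{Var})$. For a relation $S$, $S^{\equiv}$ is the smallest equivalence relation containing $S$. Satisfaction: $N,w\models_Kp$ iff $p\in V(w)$; $\neg,\wedge$ as usual; $N,w\models_KB_a\varphi$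 iff $N,u\models_K\varphi$ for all $u$ with $wR_au$; $N,w\models_KK_a\varphi$ iff $N,u\models_K\varphi$ for all $u$ with $wR_a^{\equiv}u$. Hypergraph models. A directed hyperedge over a set $\mathscr{V}$ is a pair $E=(X,Y)$ of finite disjoint (possibly empty) subsets of $\mathscr{V}$; $T(E):=X$ (tail), $H(E):=Y$ (head), $U(E):=T(E)\cup H(E)$. A directed hypergraph is a pair $G=(\mathscr{V}(G),\mathscr{E}(G))$ with $\mathscr{V}(G)$ a non-empty set and $\mathscr{E}(G)$ a set of directed hyperedges over $\mathscr{V}(G)$. $G$ is simple if for all $E_1,E_2\in\mathscr{E}(G)$, $E_1\neq E_2$ implies $U(E_1)\not\subseteq U(E_2)$; $k$-uniform if $|U(E)|=k$ for all $E\in\mathscr{E}(G)$; tail-complete if $\mathscr{V}(G)=\bigcup_{E\in\mathscr{E}(G)}T(E)$. A coloring of $G$ is a map $\chi:\mathscr{V}(G)\to\mathcal{A}$ such that for every $E\in\mathscr{E}(G)$ and all distinct $u,v\in U(E)$, $\chi(u)\neq\chi(v)$. A hypergraph model is a triple $M=(G,\chi,\ell)$ with $G$ a directed hypergraph, $\chi$ a coloring of $G$, and $\ell:\mathscr{V}(G)\to\mathcal{P}(\mathsf{Var})$ such that $\chi(u)=a$ implies $\ell(u)\subseteq\mathsf{Var}_a$. It is simple ($n$-uniform, tail-complete) if $G$ is. For $E\in\mathscr{E}(G)$ put $\ell(E):=\bigcup_{u\in U(E)}\ell(u)$. For $E_1,E_2\in\mathscr{E}(G)$: $E_1\vartriangleright_aE_2$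 iff some $u\in U(E_1)\cap T(E_2)$ has $\chi(u)=a$; $E_1\approx_aE_2$ iff some $u\in U(E_1)\cap U(E_2)$ has $\chi(u)=a$. Satisfaction: $M,E\models_Hp$ iff $p\in\ell(E)$; $\neg,\wedge$ as usual; $M,E\models_HB_a\varphi$ iff $M,E'\models_H\varphi$ for all $E'\in\mathscr{E}(G)$ with $E\vartriangleright_aE'$; $M,E\models_HK_a\varphi$ iff $M,E'\models_H\varphi$ for all $E'\in\mathscr{E}(G)$ with $E\approx_aE'$. The model $\mathfrak{K}(M)$. For a hypergraph model $M=(G,\chi,\ell)$, $\mathfrak{K}(M)=(W,R,V)$ where $W:=\mathscr{E}(G)$; $(E_1,E_2)\in R_a$ iff $E_1\vartriangleright_aE_2$; and $V(E):=\ell(E)$ for all $E\in W$. -}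

module Defs where

open import Data.Fin.Base using (Fin)
open import Data.List.Base using (List; _++_; length)
open import Data.List.Membership.Propositional using () renaming (_∈_ to _∈ᴸ_)
open import Data.List.Membership.Propositional.Properties using (∈-++⁺ˡ; ∈-++⁺ʳ; ∈-++⁻)
open import Data.List.Relation.Binary.Disjoint.Propositional using (Disjoint)
open import Data.List.Relation.Unary.Unique.Propositional using (Unique)
open import Data.List.Relation.Unary.Unique.Propositional.Properties using (++⁺)
open import Data.Nat.Base using (ℕ; _≤_)
open import Data.Product.Base using (Σ; Σ-syntax; ∃-syntax; _×_; _,_; proj₁)
open import Data.Sum.Base using (inj₁; inj₂)
open import Function.Bundles using (_↔_; _↣_)
open import Level using (0ℓ)
open import Relation.Binary.Bundles using (Setoid)
open import Relation.Binary.Construct.Closure.Equivalence using (EqClosure)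
import Relation.Binary.Construct.On as On
open import Relation.Binary.Construct.Union using () renaming (_∪_ to _∪ᴿ_)
open import Relation.Binary.Core using (Rel)
open import Relation.Binary.Definitions using (_Respects_; _Respects₂_)
open import Relation.Binary.PropositionalEquality.Core using (_≡_; _≢_)
open import Relation.Binary.Structures using (IsEquivalence)
open import Relation.Nullary.Negation.Core using (¬_)
open import Relation.Unary using (Pred; _∈_)

record Signature : Set₁ where
  field
    n           : ℕ
    n≥1         : 1 ≤ n
    Agent       : Set
    agents      : Agent ↔ Fin n
    Letter      : Agent → Set
    countable   : ∀ a → Letter a ↣ ℕ

  -- The sets of letters are pairwise disjoint, so their union is the Σ-type;
  -- the letters of agent a are those with first component a.
  Var : Set
  Var = Σ Agent Letter

  Var[_] : Agent → Pred Var 0ℓ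
  Var[ a ] p = proj₁ p ≡ a

-- Subsets given by a repetition-free enumeration, compared extensionally by _≐_.
record FinSubset (A : Set) : Set where
  field
    elements : List A
    unique   : Unique elements

open FinSubset public

module _ {A : Set} where

  infix 4 _∈ꟳ_ _⊆ꟳ_ _≐_

  _∈ꟳ_ : A → FinSubset A → Set
  x ∈ꟳ X = x ∈ᴸ elements X

  _⊆ꟳ_ : Rel (FinSubset A) 0ℓ
  X ⊆ꟳ Y = ∀ {x} → x ∈ꟳ X → x ∈ꟳ Y

  _≐_ : Rel (FinSubset A) 0ℓ
  X ≐ Y = X ⊆ꟳ Y × Y ⊆ꟳ X

  ∣_∣ : FinSubset A → ℕ
  ∣ X ∣ = length (elements X)

record DirectedHyperedge (𝒱 : Set) : Set where
  field
    T        : FinSubset 𝒱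
    H        : FinSubset 𝒱
    disjoint : Disjoint (elements T) (elements H)

  U : FinSubset 𝒱
  U = record
    { elements = elements T ++ elements H
    ; unique   = ++⁺ (unique T) (unique H) disjoint
    }

open DirectedHyperedge public

module _ {𝒱 : Set} where

  infix 4 _≋_

  _≋_ : Rel (DirectedHyperedge 𝒱) 0ℓ
  E₁ ≋ E₂ = T E₁ ≐ T E₂ × H E₁ ≐ H E₂

  ≋-isEquivalence : IsEquivalence _≋_
  ≋-isEquivalence = record
    { refl  = ((λ x → x) , (λ x → x)) , ((λ x → x) , (λ x → x))
    ; sym   = λ ((t , t′) , (h , h′)) → (t′ , t) , (h′ , h)
    ; trans = λ ((t , t′) , (h , h′)) ((s , s′) , (g , g′)) →
        ((λ x → s (t x)) , (λ x → t′ (s′ x))) ,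
        ((λ x → g (h x)) , (λ x → h′ (g′ x)))
    }

  ≋⇒U⊆U : ∀ E₁ E₂ → E₁ ≋ E₂ → U E₁ ⊆ꟳ U E₂
  ≋⇒U⊆U E₁ E₂ ((t , _) , (h , _)) u∈ with ∈-++⁻ (elements (T E₁)) u∈
  ... | inj₁ u∈T = ∈-++⁺ˡ (t u∈T)
  ... | inj₂ u∈H = ∈-++⁺ʳ (elements (T E₂)) (h u∈H)

record DirectedHypergraph : Set₁ where
  field
    𝒱        : Set
    nonempty : 𝒱
    ℰ        : Pred (DirectedHyperedge 𝒱) 0ℓ
    ℰ-resp   : ℰ Respects _≋_

  Edge : Set
  Edge = Σ[ E ∈ DirectedHyperedge 𝒱 ] E ∈ ℰ

  edges : Setoid 0ℓ 0ℓ
  edges = record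
    { Carrier       = Edge
    ; _≈_           = λ (E₁ , _) (E₂ , _) → E₁ ≋ E₂
    ; isEquivalence = On.isEquivalence proj₁ ≋-isEquivalence
    }

  Simple : Set
  Simple = ∀ E₁ E₂ → E₁ ∈ ℰ → E₂ ∈ ℰ → ¬ (E₁ ≋ E₂) → ¬ (U E₁ ⊆ꟳ U E₂)

  Uniform : ℕ → Set
  Uniform k = ∀ E → E ∈ ℰ → ∣ U E ∣ ≡ k

  TailComplete : Set
  TailComplete = ∀ u → ∃[ E ] E ∈ ℰ × u ∈ꟳ T E

module _ (S : Signature) where
  open Signature S

  IsColoring : (G : DirectedHypergraph) → (DirectedHypergraph.𝒱 G → Agent) → Set
  IsColoring G χ = ∀ E → E ∈ ℰ → ∀ u v → u ∈ꟳ U E → v ∈ꟳ U E → u ≢ v → χ u ≢ χ v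
    where open DirectedHypergraph G

  record HypergraphModel : Set₁ where
    field
      G : DirectedHypergraph

    open DirectedHypergraph G public

    field
      χ          : 𝒱 → Agent
      isColoring : IsColoring G χ
      ℓ          : 𝒱 → Pred Var 0ℓ
      ℓ-local    : ∀ u a → χ u ≡ a → ∀ p → p ∈ ℓ u → p ∈ Var[ a ]

    ℓᴱ : DirectedHyperedge 𝒱 → Pred Var 0ℓ
    ℓᴱ E p = ∃[ u ] u ∈ꟳ U E × p ∈ ℓ u

    ▷ : Agent → Rel Edge 0ℓ
    ▷ a (E₁ , _) (E₂ , _) = ∃[ u ] (u ∈ꟳ U E₁ × u ∈ꟳ T E₂) × χ u ≡ a

    ≈ : Agent → Rel Edge 0ℓ
    ≈ a (E₁ , _) (E₂ , _) = ∃[ u ] (u ∈ꟳ U E₁ × u ∈ꟳ U E₂) × χ u ≡ a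

  ℋˢᵘ : Pred HypergraphModel 0ℓ
  ℋˢᵘ M = Simple × Uniform n
    where open HypergraphModel M

  ℋˢᵘᵗ : Pred HypergraphModel 0ℓ
  ℋˢᵘᵗ M = Simple × Uniform n × TailComplete
    where open HypergraphModel M

  -- Worlds form a setoid, because a set of hyperedges is one.
  record KripkeModel : Set₁ where
    field
      W        : Setoid 0ℓ 0ℓ

    open Setoid W public using () renaming (Carrier to World; _≈_ to _≈ᵂ_)

    field
      nonempty : World
      R        : Agent → Rel World 0ℓ
      R-resp   : ∀ a → R a Respects₂ _≈ᵂ_
      V        : World → Pred Var 0ℓ
      V-resp   : ∀ p → (λ w → p ∈ V w) Respects _≈ᵂ_

    -- EqClosure is reflexive only up to _≡_, while an equivalence relation
    -- on the worlds has to relate all worlds that are equal in W.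
    R≡ : Agent → Rel World 0ℓ
    R≡ a = EqClosure (_≈ᵂ_ ∪ᴿ R a)

  infix  9 ~_
  infixr 8 _⩓_

  data 𝓛ᴮᴷ : Set where
    var : Var → 𝓛ᴮᴷ
    ~_  : 𝓛ᴮᴷ → 𝓛ᴮᴷ
    _⩓_ : 𝓛ᴮᴷ → 𝓛ᴮᴷ → 𝓛ᴮᴷ
    B   : Agent → 𝓛ᴮᴷ → 𝓛ᴮᴷ
    K   : Agent → 𝓛ᴮᴷ → 𝓛ᴮᴷ

  data 𝓛ᴮ : Pred 𝓛ᴮᴷ 0ℓ where
    var : ∀ p → var p ∈ 𝓛ᴮ
    ~_  : ∀ {φ} → φ ∈ 𝓛ᴮ → (~ φ) ∈ 𝓛ᴮ
    _⩓_ : ∀ {φ ψ} → φ ∈ 𝓛ᴮ → ψ ∈ 𝓛ᴮ → (φ ⩓ ψ) ∈ 𝓛ᴮ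
    B   : ∀ a {φ} → φ ∈ 𝓛ᴮ → B a φ ∈ 𝓛ᴮ

module _ {S : Signature} where

  infix 3 _,_⊨ᴷ_ _,_⊨ᴴ_

  _,_⊨ᴷ_ : (N : KripkeModel S) → KripkeModel.World N → 𝓛ᴮᴷ S → Set
  N , w ⊨ᴷ var p = p ∈ KripkeModel.V N w
  N , w ⊨ᴷ ~ φ   = ¬ (N , w ⊨ᴷ φ)
  N , w ⊨ᴷ φ ⩓ ψ = (N , w ⊨ᴷ φ) × (N , w ⊨ᴷ ψ)
  N , w ⊨ᴷ B a φ = ∀ u → KripkeModel.R N a w u → N , u ⊨ᴷ φ
  N , w ⊨ᴷ K a φ = ∀ u → KripkeModel.R≡ N a w u → N , u ⊨ᴷ φ

  _,_⊨ᴴ_ : (M : HypergraphModel S) → HypergraphModel.Edge M → 𝓛ᴮᴷ S → Set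
  M , E ⊨ᴴ var p = p ∈ HypergraphModel.ℓᴱ M (proj₁ E)
  M , E ⊨ᴴ ~ φ   = ¬ (M , E ⊨ᴴ φ)
  M , E ⊨ᴴ φ ⩓ ψ = (M , E ⊨ᴴ φ) × (M , E ⊨ᴴ ψ)
  M , E ⊨ᴴ B a φ = ∀ E′ → HypergraphModel.▷ M a E E′ → M , E′ ⊨ᴴ φ
  M , E ⊨ᴴ K a φ = ∀ E′ → HypergraphModel.≈ M a E E′ → M , E′ ⊨ᴴ φ

  -- A hypergraph may have no hyperedges, so 𝔎 takes one to witness that its
  -- set of worlds is non-empty; nothing else depends on the choice.
  𝔎 : (M : HypergraphModel S) → HypergraphModel.Edge M → KripkeModel S
  𝔎 M E₀ = record
    { W        = edges
    ; nonempty = E₀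
    ; R        = ▷
    ; R-resp   = λ a →
        (λ ((t , _) , _) (u , (u∈U , u∈T) , χu) → u , (u∈U , t u∈T) , χu) ,
        (λ {(F , _)} {(E , _)} {(E′ , _)} e (u , (u∈U , u∈T) , χu) →
          u , (≋⇒U⊆U E E′ e u∈U , u∈T) , χu)
    ; V        = λ (E , _) → ℓᴱ E
    ; V-resp   = λ p {(E , _)} {(E′ , _)} e (u , u∈U , p∈ℓu) →
        u , ≋⇒U⊆U E E′ e u∈U , p∈ℓu
    }
    where open HypergraphModel M

{-# OPTIONS --safe #-}
module Submission where

-- In a colored n-uniform hypergraph each hyperedge has exactly one vertex of
-- every color, so ≈ a is an equivalence relation: reflexive because a vertex of
-- color a exists, transitive because it is unique. It contains ▷ a, hence also
-- R≡ a. Conversely, if E₁ and E₂ share the vertex u of color a, then by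
-- tail-completeness u is in the tail of some F, and E₁ ▷ F ◁ E₂.

open import Defs
open import Data.Fin.Base using (Fin; zero; suc; punchOut)
open import Data.Fin.Properties using (_≟_; any?; injective⇒≤; punchOut-injective)
open import Data.List.Base using (List; lookup)
open import Data.List.Membership.Propositional.Properties using (∈-lookup; ∈-++⁺ˡ)
import Data.List.Relation.Unary.All as All
open import Data.List.Relation.Unary.AllPairs using (_∷_)
open import Data.List.Relation.Unary.Any using (index)
open import Data.List.Relation.Unary.Any.Properties using (lookup-index)
open import Data.List.Relation.Unary.Unique.Propositional using (Unique)
open import Data.Nat.Base using (suc)
open import Data.Nat.Properties using (1+n≰n)
open import Data.Product.Base using (∃-syntax; _×_; _,_; proj₁)
open import Data.Product.Function.NonDependent.Propositional using (_×-⇔_)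
open import Data.Sum.Base using ([_,_]; inj₂)
open import Function.Base using (_∘_)
open import Function.Bundles using (_⇔_; mk⇔; module Equivalence; module Inverse)
open import Function.Construct.Identity using (⇔-id)
open import Function.Definitions using (Injective)
open import Function.Related.TypeIsomorphisms using (→-cong-⇔; ¬-cong-⇔)
open import Level using (Level)
open import Relation.Binary.Construct.Closure.Equivalence using (fold)
open import Relation.Binary.Construct.Closure.ReflexiveTransitive using (ε; _◅_)
open import Relation.Binary.Construct.Closure.Symmetric using (fwd; bwd)
open import Relation.Binary.PropositionalEquality.Core using (_≡_; refl; sym; trans; cong; subst)
open import Relation.Binary.PropositionalEquality.Properties using (module ≡-Reasoning)
open import Relation.Binary.Structures using (IsEquivalence)
open import Relation.Nullary.Decidable.Core using (yes; no; decidable-stable)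
open import Relation.Nullary.Negation.Core using (contradiction)
open import Relation.Unary using (Pred; _∈_)

private
  variable
    a p q : Level
    A : Set a

-- Pigeonhole: if `j` is missed, punching it out of the codomain leaves an injection of `suc n`
-- points into `n`.
injective⇒surjective : ∀ {n} {f : Fin n → Fin n} → Injective _≡_ _≡_ f →
                       ∀ j → ∃[ i ] f i ≡ j
injective⇒surjective {suc n} {f} f-injective j with any? (λ i → f i ≟ j)
... | yes hit  = hit
... | no  miss = contradiction
  (injective⇒≤ (f-injective ∘ punchOut-injective (j≢f _) (j≢f _))) 1+n≰n
  where j≢f = λ i j≡fi → miss (i , sym j≡fi)

lookup-injective : ∀ {xs : List A} → Unique xs → Injective _≡_ _≡_ (lookup xs)
lookup-injective (_ ∷ _)    {zero}  {zero}  _  = refl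
lookup-injective (x∉ ∷ _)   {zero}  {suc j} eq =
  contradiction eq (All.lookup x∉ (∈-lookup j))
lookup-injective (x∉ ∷ _)   {suc i} {zero}  eq =
  contradiction (sym eq) (All.lookup x∉ (∈-lookup i))
lookup-injective (_ ∷ uniq) {suc i} {suc j} eq = cong suc (lookup-injective uniq eq)

Π-cong-⇔ : {P : Pred A p} {Q : Pred A q} → (∀ x → P x ⇔ Q x) → (∀ x → P x) ⇔ (∀ x → Q x)
Π-cong-⇔ P⇔Q = mk⇔ (λ f x → Equivalence.to (P⇔Q x) (f x))
                   (λ g x → Equivalence.from (P⇔Q x) (g x))

module _ {S : Signature} (M : HypergraphModel S) where
  open Signature S
  open HypergraphModel M
  open Inverse agents using (to; from; strictlyInverseʳ)

  -- Colors are read off positions and numbered through `agents`, so that on a hyperedge of size `n`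
  -- this is a map between finite sets of equal size.
  color : (E : DirectedHyperedge 𝒱) → Fin ∣ U E ∣ → Fin n
  color E i = to (χ (lookup (elements (U E)) i))

  -- IsColoring only refutes χ u ≡ χ v for distinct vertices; decidable equality
  -- of positions (vertices have none) is what turns this into injectivity.
  color-injective : ∀ {E} → E ∈ ℰ → Injective _≡_ _≡_ (color E)
  color-injective {E} E∈ℰ {i} {j} eq = decidable-stable (i ≟ j) λ i≢j →
    isColoring E E∈ℰ _ _ (∈-lookup i) (∈-lookup j)
      (i≢j ∘ lookup-injective (unique (U E))) (to-injective eq)
    where
    to-injective : Injective _≡_ _≡_ to
    to-injective {b} {c} tb≡tc =
      trans (sym (strictlyInverseʳ b)) (trans (cong from tb≡tc) (strictlyInverseʳ c))

  -- Both vertices are traced back to the positions given by their membership proofs;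
  -- `color-injective` identifies these positions, hence what stands there.
  same-color⇒≡ : ∀ {E} → E ∈ ℰ → ∀ {u v} → u ∈ꟳ U E → v ∈ꟳ U E → χ u ≡ χ v → u ≡ v
  same-color⇒≡ {E} E∈ℰ {u} {v} u∈U v∈U χu≡χv = begin
    u                                   ≡⟨ lookup-index u∈U ⟩
    lookup (elements (U E)) (index u∈U) ≡⟨ cong (lookup (elements (U E))) (color-injective E∈ℰ same-color) ⟩
    lookup (elements (U E)) (index v∈U) ≡⟨ lookup-index v∈U ⟨
    v                                   ∎
    where
    open ≡-Reasoning
    same-color : color E (index u∈U) ≡ color E (index v∈U)
    same-color = begin
      color E (index u∈U) ≡⟨ cong (to ∘ χ) (lookup-index u∈U) ⟨
      to (χ u)            ≡⟨ cong to χu≡χv ⟩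
      to (χ v)            ≡⟨ cong (to ∘ χ) (lookup-index v∈U) ⟩
      color E (index v∈U) ∎

  module _ (uniform : Uniform n) where

    -- By uniformity `color E` is an injection between two sets of `n` elements, hence onto.
    every-color : ∀ {E} → E ∈ ℰ → ∀ a → ∃[ u ] u ∈ꟳ U E × χ u ≡ a
    every-color {E} E∈ℰ a with color-surjective (uniform E E∈ℰ) (color-injective E∈ℰ) (to a)
      where
      -- The size is abstracted to a variable `m`, so that the equation `m ≡ n` can be matched with
      -- `refl`.
      color-surjective : ∀ {m} → m ≡ n → {f : Fin m → Fin n} → Injective _≡_ _≡_ f →
                         ∀ j → ∃[ i ] f i ≡ j
      color-surjective refl = injective⇒surjective
    ... | i , eq = _ , ∈-lookup i ,
      trans (sym (strictlyInverseʳ _)) (trans (cong from eq) (strictlyInverseʳ a))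

    ≈-isEquivalence : ∀ a → IsEquivalence (≈ a)
    ≈-isEquivalence a = record
      { refl  = λ {(_ , E∈ℰ)} → let (u , u∈U , χu) = every-color E∈ℰ a in u , (u∈U , u∈U) , χu
      ; sym   = λ (u , (u∈U₁ , u∈U₂) , χu) → u , (u∈U₂ , u∈U₁) , χu
      ; trans = λ {_} {(_ , E₂∈ℰ)} {(E₃ , _)} (u , (u∈U₁ , u∈U₂) , χu) (v , (v∈U₂ , v∈U₃) , χv) →
          let v≡u = same-color⇒≡ E₂∈ℰ v∈U₂ u∈U₂ (trans χv (sym χu)) in
          u , (u∈U₁ , subst (_∈ꟳ U E₃) v≡u v∈U₃) , χu
      }

    ≈⇔R≡ : TailComplete → ∀ E₀ a {E E′} → ≈ a E E′ ⇔ KripkeModel.R≡ (𝔎 M E₀) a E E′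
    ≈⇔R≡ tailComplete E₀ a = mk⇔
      (λ (u , (u∈U , u∈U′) , χu) → let (F , F∈ℰ , u∈T) = tailComplete u in
        fwd {b = F , F∈ℰ} (inj₂ (u , (u∈U , u∈T) , χu)) ◅
        bwd (inj₂ (u , (u∈U′ , u∈T) , χu)) ◅ ε)
      -- As `≈ a` is an equivalence relation, it suffices that it contains the two generators of
      -- `R≡ a`: equality of worlds and `▷ a`.
      (fold {S = ≈ a} (≈-isEquivalence a) (λ {F F′} → [ ≋⇒≈ F F′ , ▷⇒≈ F F′ ]))
      where
      -- Equal worlds may differ as terms, so reflexivity of `≈ a` does not apply as it stands; the
      -- vertex of color `a` in `E` is carried over to `E′`.
      ≋⇒≈ : ∀ E E′ → proj₁ E ≋ proj₁ E′ → ≈ a E E′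
      ≋⇒≈ (E , E∈ℰ) (E′ , _) E≋E′ = let (u , u∈U , χu) = every-color E∈ℰ a in
        u , (u∈U , ≋⇒U⊆U E E′ E≋E′ u∈U) , χu

      ▷⇒≈ : ∀ E E′ → ▷ a E E′ → ≈ a E E′
      ▷⇒≈ _ _ (u , (u∈U , u∈T) , χu) = u , (u∈U , ∈-++⁺ˡ u∈T) , χu

  -- The relations and the valuation of `𝔎 M E₀` are `▷` and `ℓᴱ` by definition, so each clause is
  -- the same on both sides. `E₀` stays fixed while `E` varies, because `B` moves to other worlds of
  -- one and the same Kripke model.
  𝔎-truthᴮ : ∀ E₀ {φ} → φ ∈ 𝓛ᴮ S → ∀ E → (M , E ⊨ᴴ φ) ⇔ (𝔎 M E₀ , E ⊨ᴷ φ)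
  𝔎-truthᴮ E₀ (var p) E = ⇔-id _
  𝔎-truthᴮ E₀ (~ φ)   E = ¬-cong-⇔ (𝔎-truthᴮ E₀ φ E)
  𝔎-truthᴮ E₀ (φ ⩓ ψ) E = 𝔎-truthᴮ E₀ φ E ×-⇔ 𝔎-truthᴮ E₀ ψ E
  𝔎-truthᴮ E₀ (B a φ) E = Π-cong-⇔ λ F → →-cong-⇔ (⇔-id _) (𝔎-truthᴮ E₀ φ F)

  𝔎-truthᴮᴷ : Uniform n → TailComplete →
              ∀ E₀ φ E → (M , E ⊨ᴴ φ) ⇔ (𝔎 M E₀ , E ⊨ᴷ φ)
  𝔎-truthᴮᴷ uni tc E₀ = truth
    where
    truth : ∀ φ E → (M , E ⊨ᴴ φ) ⇔ (𝔎 M E₀ , E ⊨ᴷ φ)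
    truth (var p) E = ⇔-id _
    truth (~ φ)   E = ¬-cong-⇔ (truth φ E)
    truth (φ ⩓ ψ) E = truth φ E ×-⇔ truth ψ E
    truth (B a φ) E = Π-cong-⇔ λ F → →-cong-⇔ (⇔-id _) (truth φ F)
    -- Only here do the two sides quantify along different relations, which `≈⇔R≡` exchanges.
    truth (K a φ) E = Π-cong-⇔ λ F → →-cong-⇔ (≈⇔R≡ uni tc E₀ a) (truth φ F)

proposition6 : (S : Signature) (M : HypergraphModel S) (E : HypergraphModel.Edge M) →
    (M ∈ ℋˢᵘ S → ∀ φ → φ ∈ 𝓛ᴮ S → (M , E ⊨ᴴ φ) ⇔ (𝔎 M E , E ⊨ᴷ φ)) ×
    (M ∈ ℋˢᵘᵗ S → ∀ φ → (M , E ⊨ᴴ φ) ⇔ (𝔎 M E , E ⊨ᴷ φ))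
proposition6 S M E =
  (λ _ φ φ∈𝓛ᴮ → 𝔎-truthᴮ M E φ∈𝓛ᴮ E) ,
  (λ (_ , uniform , tailComplete) φ → 𝔎-truthᴮᴷ M uniform tailComplete E φ E)
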